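{- For $|q|<1$ (equivalently, as formal power series in $q$), $$\frac{f_1^2 f_6}{f_2 f_3^2}+\frac{f_2^2 f_{12}}{f_4 f_6^2}=2\,\frac{f_1 f_{16} f_{24}^2}{f_3 f_6 f_8 f_{48}}.$$
   Context: For a positive integer $n$, $f_n:=(q^n;q^n)_\infty=\prod_{j=1}^\infty(1-q^{nj})$. -}

module Defs where

open import Data.Bool.Base using (if_then_else_)
open import Data.Fin.Base using (Fin; zero; suc; toℕ)
import Data.Fin.Properties as Fin
open import Data.Integer.Base as ℤ using (ℤ; 0ℤ; 1ℤ)
import Data.Integer.Properties as ℤ
open import Data.Nat.Base as ℕ using (ℕ; zero; suc; _∸_; _≤_; _<_; _≡ᵇ_; NonZero)
import Data.Nat.Properties as ℕ
open import Function.Base using (_∘_)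
open import Relation.Binary.PropositionalEquality
open import Relation.Nullary.Decidable using (True; toWitness)

open import Algebra.Properties.CommutativeMonoid.Sum ℤ.+-0-commutativeMonoid
  using (sum-syntax; sum⁺-syntax; sum-cong-≗; sum-replicate-zero)

-- Formal power series in q over ℤ: a n is the coefficient of qⁿ.
-- Equality of series is pointwise equality _≗_.
Series : Set
Series = ℕ → ℤ

infixl 6 _+_ _-_
infixl 7 _*_ _/_
infixr 7 _·_
infixr 8 _^_

_+_ _-_ _*_ : Series → Series → Series
(a + b) n = a n ℤ.+ b n
(a - b) n = a n ℤ.- b n
(a * b) n = ∑[ i ≤ n ] (a (toℕ i) ℤ.* b (n ∸ toℕ i))

_·_ : ℤ → Series → Series
(c · a) n = c ℤ.* a n

q^_ : ℕ → Series
(q^ m) n = if n ≡ᵇ m then 1ℤ else 0ℤ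

one : Series
one = q^ 0

_^_ : Series → ℕ → Series
a ^ zero  = one
a ^ suc k = a ^ k * a

-- Long division by a series b with constant term 1: the quotient a / b
-- starts with a 0, and its remaining coefficients are those of
-- ((a - a 0 · b) / q) / b.  By *-/ and /-unique below, it is the unique
-- series x with x * b ≗ a.
remainder quotient : Series → Series → Series
remainder a b n = a (suc n) ℤ.- a 0 ℤ.* b (suc n)

quotient a b zero    = a 0
quotient a b (suc n) = quotient (remainder a b) b n

-- The implicit argument is solved automatically whenever b 0 evaluates to 1.
_/_ : (a b : Series) → {True (b 0 ℤ.≟ 1ℤ)} → Series
a / b = quotient a b

-- (qⁿ;qⁿ)_m = ∏_{j=1}^{m} (1 - q^{nj})
pochhammer : ℕ → ℕ → Series
pochhammer n zero    = one
pochhammer n (suc m) = (one - q^ (n ℕ.* suc m)) * pochhammer n m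

-- f n = (qⁿ;qⁿ)_∞.  For n ≥ 1 the factors with j > k do not affect the
-- coefficient of qᵏ, so the coefficient of qᵏ in the infinite product is the
-- one in (qⁿ;qⁿ)_k; see f-limit below.
f : (n : ℕ) → .{{NonZero n}} → Series
f n k = pochhammer n k k

private
  +-cancel : ∀ x y → x ℤ.+ (y ℤ.- x) ≡ y
  +-cancel x y = begin
    x ℤ.+ (y ℤ.- x)        ≡⟨ ℤ.+-comm x _ ⟩
    y ℤ.- x ℤ.+ x          ≡⟨ ℤ.+-assoc y (ℤ.- x) x ⟩
    y ℤ.+ (ℤ.- x ℤ.+ x)    ≡⟨ cong (λ z → y ℤ.+ z) (ℤ.+-inverseˡ x) ⟩
    y ℤ.+ 0ℤ               ≡⟨ ℤ.+-identityʳ y ⟩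
    y                      ∎
    where open ≡-Reasoning

  head-* : ∀ a b → b 0 ≡ 1ℤ → (a * b) 0 ≡ a 0
  head-* a b b₀ = begin
    a 0 ℤ.* b 0 ℤ.+ 0ℤ  ≡⟨ ℤ.+-identityʳ _ ⟩
    a 0 ℤ.* b 0         ≡⟨ cong (λ z → a 0 ℤ.* z) b₀ ⟩
    a 0 ℤ.* 1ℤ          ≡⟨ ℤ.*-identityʳ (a 0) ⟩
    a 0                 ∎
    where open ≡-Reasoning

  quotient-* : ∀ a b → b 0 ≡ 1ℤ → quotient a b * b ≗ a
  quotient-* a b b₀ zero    = head-* (quotient a b) b b₀
  quotient-* a b b₀ (suc n) = trans
    (cong (λ z → a 0 ℤ.* b (suc n) ℤ.+ z) (quotient-* (remainder a b) b b₀ n))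
    (+-cancel (a 0 ℤ.* b (suc n)) (a (suc n)))

  quotient-unique : ∀ a b x → b 0 ≡ 1ℤ → x * b ≗ a → x ≗ quotient a b
  quotient-unique a b x b₀ eq zero    = trans (sym (head-* x b b₀)) (eq 0)
  quotient-unique a b x b₀ eq (suc n) =
    quotient-unique (remainder a b) b (x ∘ suc) b₀ tail-eq n
    where
    x₀≡a₀ : x 0 ≡ a 0
    x₀≡a₀ = trans (sym (head-* x b b₀)) (eq 0)

    tail-eq : ∀ k → ((x ∘ suc) * b) k ≡ remainder a b k
    tail-eq k = begin
      t                                ≡⟨ +-cancel h t ⟨
      h ℤ.+ (t ℤ.- h)                  ≡⟨ ℤ.+-assoc h t (ℤ.- h) ⟨
      h ℤ.+ t ℤ.- h                    ≡⟨ cong₂ (λ y z → y ℤ.- z ℤ.* b (suc k)) (eq (suc k)) x₀≡a₀ ⟩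
      remainder a b k                  ∎
      where
      open ≡-Reasoning
      h = x 0 ℤ.* b (suc k)
      t = ((x ∘ suc) * b) k

*-/ : ∀ a b {b₀ : True (b 0 ℤ.≟ 1ℤ)} → (a / b) {b₀} * b ≗ a
*-/ a b {b₀} = quotient-* a b (toWitness b₀)

/-unique : ∀ a b x {b₀ : True (b 0 ℤ.≟ 1ℤ)} → x * b ≗ a → x ≗ (a / b) {b₀}
/-unique a b x {b₀} = quotient-unique a b x (toWitness b₀)

private
  q^-< : ∀ {i m} → i < m → (q^ m) i ≡ 0ℤ
  q^-< {zero}  {suc m} _           = refl
  q^-< {suc i} {suc m} (ℕ.s≤s i<m) = q^-< i<m

  factor-* : ∀ a {k m} → k < m → ((one - q^ m) * a) k ≡ a k
  factor-* a {k} {m} k<m = begin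
    d 0 ℤ.* a k ℤ.+ ∑[ i < k ] (d (suc (toℕ i)) ℤ.* a (k ∸ suc (toℕ i)))
      ≡⟨ cong₂ (λ y z → y ℤ.* a k ℤ.+ z)
           (cong (λ z → 1ℤ ℤ.- z) (q^-< (ℕ.≤-<-trans ℕ.z≤n k<m)))
           (sum-cong-≗ vanish) ⟩
    1ℤ ℤ.* a k ℤ.+ ∑[ i < k ] 0ℤ
      ≡⟨ cong₂ ℤ._+_ (ℤ.*-identityˡ (a k)) (sum-replicate-zero k) ⟩
    a k ℤ.+ 0ℤ
      ≡⟨ ℤ.+-identityʳ (a k) ⟩
    a k ∎
    where
    open ≡-Reasoning
    d = one - q^ m

    vanish : (i : Fin k) → d (suc (toℕ i)) ℤ.* a (k ∸ suc (toℕ i)) ≡ 0ℤ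
    vanish i = trans
      (cong (λ z → (0ℤ ℤ.- z) ℤ.* a (k ∸ suc (toℕ i)))
        (q^-< (ℕ.≤-<-trans (Fin.toℕ<n i) k<m)))
      (ℤ.*-zeroˡ (a (k ∸ suc (toℕ i))))

  pochhammer-stable : ∀ n .{{_ : NonZero n}} k d → pochhammer n (d ℕ.+ k) k ≡ f n k
  pochhammer-stable n k zero    = refl
  pochhammer-stable n k (suc d) = trans
    (factor-* (pochhammer n (d ℕ.+ k))
      (ℕ.<-≤-trans (ℕ.s≤s (ℕ.m≤n+m k d)) (ℕ.m≤n*m (suc (d ℕ.+ k)) n)))
    (pochhammer-stable n k d)

f-limit : ∀ n .{{_ : NonZero n}} {k m} → k ≤ m → pochhammer n m k ≡ f n k
f-limit n {k} {m} k≤m =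
  subst (λ l → pochhammer n l k ≡ f n k) (ℕ.m∸n+n≡m k≤m) (pochhammer-stable n k (m ∸ k))

{-# OPTIONS --safe #-}

-- Put A = f(q,q⁵), A′ = f(-q,-q⁵) and B = f(q⁸,q¹⁶), where
-- f(x,y) = (-x;xy)∞ (-y;xy)∞ (xy;xy)∞ is Ramanujan's theta function.
-- Rearranging products gives
--   A = f₂² f₃ f₁₂ / (f₁ f₄ f₆),  A′ = f₁ f₆² / (f₂ f₃),  B = f₁₆ f₂₄² / (f₈ f₄₈),
-- so the claim is the identity A′ + A = 2 B multiplied by f₁ / (f₃ f₆).  By the
-- Jacobi triple product A and A′ are the sums of (±1)ⁿ q^(3n² - 2n) over n ∈ ℤ,
-- and the even terms n = 2m of the former make up B.  All of this is carried
-- out modulo q^K for every K, that is, in a ring in which q^K = 0, where the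
-- infinite products are finite and the triple product is a case of the
-- q-binomial theorem.
module Submission where

open import Algebra.Bundles using (CommutativeRing)
open import Algebra.Structures using (IsCommutativeRing)
open import Data.Fin.Base using (toℕ)
import Data.Fin.Properties as Fin
open import Data.Integer.Base as ℤ using (ℤ; +_; 0ℤ)
import Data.Integer.Properties as ℤ
open import Data.Integer.Solver using (module +-*-Solver)
open import Data.Nat.Base as ℕ using (ℕ; zero; suc; s≤s; NonZero; _∸_)
import Data.Nat.Properties as ℕ
open import Data.Product.Base using (∃; _,_)
open import Function.Base using (_∘_)
open import Relation.Binary.PropositionalEquality as ≡ using (_≡_; _≗_)
open import Relation.Nullary.Decidable using (yes; no)

-- Finite q-series in a commutative ring

module QSeries {c ℓ} (R : CommutativeRing c ℓ) where
  open CommutativeRing R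
  open import Algebra.Properties.Ring ring using (-‿distribˡ-*; -‿distribʳ-*; -‿involutive; -1*x≈-x)
  open import Algebra.Properties.CommutativeSemiring.Exp commutativeSemiring public
    using (_^_; ^-congˡ; ^-homo-*; ^-assocʳ; ^-distrib-*)
  open import Algebra.Properties.Semiring.Sum semiring
    using (sum; sum-cong-≋; ∑-distrib-+; *-distribˡ-sum; *-distribʳ-sum)
  open import Algebra.Solver.Ring.NaturalCoefficients.Default commutativeSemiring
    using (solve; _:*_; _:+_; _:=_; con)
  open import Relation.Binary.Reasoning.Setoid setoid

  -- Sums over initial segments of the natural numbers.

  ∑< : ℕ → (ℕ → Carrier) → Carrier
  ∑< n g = sum {n} (g ∘ toℕ)

  ∑<-cong : ∀ n {g h} → (∀ k → k ℕ.< n → g k ≈ h k) → ∑< n g ≈ ∑< n h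
  ∑<-cong n g≈h = sum-cong-≋ λ i → g≈h (toℕ i) (Fin.toℕ<n i)

  ∑<-+ : ∀ n g h → ∑< n (λ k → g k + h k) ≈ ∑< n g + ∑< n h
  ∑<-+ n g h = ∑-distrib-+ {n} (g ∘ toℕ) (h ∘ toℕ)

  ∑<-last : ∀ n g → ∑< (suc n) g ≈ ∑< n g + g n
  ∑<-last zero    g = +-comm _ _
  ∑<-last (suc n) g = trans (+-congˡ (∑<-last n (g ∘ suc))) (sym (+-assoc _ _ _))

  ∑<-evens : ∀ n g → (∀ k → g (suc (2 ℕ.* k)) ≈ 0#) →
             ∑< (suc (2 ℕ.* n)) g ≈ ∑< (suc n) (λ k → g (2 ℕ.* k))
  ∑<-evens zero    g odd = refl
  ∑<-evens (suc n) g odd = +-congˡ (begin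
    ∑< (2 ℕ.* suc n) (g ∘ suc)
      ≡⟨ ≡.cong (λ l → ∑< l (g ∘ suc)) (ℕ.*-suc 2 n) ⟩
    g 1 + ∑< (suc (2 ℕ.* n)) (g ∘ suc ∘ suc)
      ≈⟨ +-congʳ (odd 0) ⟩
    0# + ∑< (suc (2 ℕ.* n)) (g ∘ suc ∘ suc)
      ≈⟨ +-identityˡ _ ⟩
    ∑< (suc (2 ℕ.* n)) (g ∘ suc ∘ suc)
      ≈⟨ ∑<-evens n (g ∘ suc ∘ suc) (λ k →
           trans (reflexive (≡.cong (g ∘ suc) (≡.sym (ℕ.*-suc 2 k)))) (odd (suc k))) ⟩
    ∑< (suc n) (λ k → g (suc (suc (2 ℕ.* k))))
      ≈⟨ ∑<-cong (suc n) (λ k _ → reflexive (≡.cong g (≡.sym (ℕ.*-suc 2 k)))) ⟩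
    ∑< (suc n) (λ k → g (2 ℕ.* suc k)) ∎)

  -- Finite products and their splittings.

  -- (-z;Q)ₘ
  product : Carrier → Carrier → ℕ → Carrier
  product z Q zero    = 1#
  product z Q (suc m) = product z Q m * (1# + z * Q ^ m)

  product-cong : ∀ {z z′ Q Q′} m → z ≈ z′ → Q ≈ Q′ → product z Q m ≈ product z′ Q′ m
  product-cong zero    z≈ Q≈ = refl
  product-cong (suc m) z≈ Q≈ =
    *-cong (product-cong m z≈ Q≈) (+-congˡ (*-cong z≈ (^-congˡ m Q≈)))

  product-head : ∀ z Q m → product z Q (suc m) ≈ (1# + z) * product (z * Q) Q m
  product-head z Q zero    = solve 1 (λ z → con 1 :* (con 1 :+ z :* con 1) := (con 1 :+ z) :* con 1) refl z
  product-head z Q (suc m) = begin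
    product z Q (suc m) * (1# + z * Q ^ suc m)
      ≈⟨ *-congʳ (product-head z Q m) ⟩
    (1# + z) * product (z * Q) Q m * (1# + z * (Q * Q ^ m))
      ≈⟨ solve 4 (λ z Q p r → (con 1 :+ z) :* p :* (con 1 :+ z :* (Q :* r))
                  := (con 1 :+ z) :* (p :* (con 1 :+ z :* Q :* r))) refl z Q _ _ ⟩
    (1# + z) * product (z * Q) Q (suc m) ∎

  -- Factors are sorted by the parity of their index; `product-split₃` sorts them modulo 3 in the
  -- same way.
  product-split₂ : ∀ z Q m → product z Q (2 ℕ.* m) ≈ product z (Q ^ 2) m * product (z * Q) (Q ^ 2) m
  product-split₂ z Q zero    = sym (*-identityˡ 1#)
  product-split₂ z Q (suc m) = begin
    product z Q (2 ℕ.* suc m)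
      ≡⟨ ≡.cong (product z Q) (ℕ.*-suc 2 m) ⟩
    product z Q (2 ℕ.* m) * (1# + z * Q ^ (2 ℕ.* m)) * (1# + z * (Q * Q ^ (2 ℕ.* m)))
      ≈⟨ *-cong (*-cong (product-split₂ z Q m) (+-congˡ (*-congˡ Q²ᵐ))) (+-congˡ (*-congˡ (*-congˡ Q²ᵐ))) ⟩
    product z (Q ^ 2) m * product (z * Q) (Q ^ 2) m * (1# + z * r) * (1# + z * (Q * r))
      ≈⟨ solve 5 (λ a b z Q r → a :* b :* (con 1 :+ z :* r) :* (con 1 :+ z :* (Q :* r))
                  := a :* (con 1 :+ z :* r) :* (b :* (con 1 :+ z :* Q :* r))) refl _ _ z Q r ⟩
    product z (Q ^ 2) (suc m) * product (z * Q) (Q ^ 2) (suc m) ∎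
    where
    r = (Q ^ 2) ^ m
    Q²ᵐ : Q ^ (2 ℕ.* m) ≈ r
    Q²ᵐ = sym (^-assocʳ Q 2 m)

  product-split₃ : ∀ z Q m → product z Q (3 ℕ.* m) ≈
    product z (Q ^ 3) m * product (z * Q) (Q ^ 3) m * product (z * Q ^ 2) (Q ^ 3) m
  product-split₃ z Q zero    = sym (trans (*-congʳ (*-identityˡ 1#)) (*-identityˡ 1#))
  product-split₃ z Q (suc m) = begin
    product z Q (3 ℕ.* suc m)
      ≡⟨ ≡.cong (product z Q) (ℕ.*-suc 3 m) ⟩
    product z Q (3 ℕ.* m) * (1# + z * Q ^ (3 ℕ.* m)) * (1# + z * (Q * Q ^ (3 ℕ.* m)))
      * (1# + z * (Q * (Q * Q ^ (3 ℕ.* m))))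
      ≈⟨ *-cong (*-cong (*-cong (product-split₃ z Q m) (+-congˡ (*-congˡ Q³ᵐ)))
                        (+-congˡ (*-congˡ (*-congˡ Q³ᵐ))))
                (+-congˡ (*-congˡ (*-congˡ (*-congˡ Q³ᵐ)))) ⟩
    product z (Q ^ 3) m * product (z * Q) (Q ^ 3) m * product (z * Q ^ 2) (Q ^ 3) m
      * (1# + z * r) * (1# + z * (Q * r)) * (1# + z * (Q * (Q * r)))
      ≈⟨ solve 6 (λ a b c z Q r → a :* b :* c :* (con 1 :+ z :* r) :* (con 1 :+ z :* (Q :* r))
                       :* (con 1 :+ z :* (Q :* (Q :* r)))
                  := a :* (con 1 :+ z :* r) :* (b :* (con 1 :+ z :* Q :* r))
                       :* (c :* (con 1 :+ z :* (Q :* (Q :* con 1)) :* r))) refl _ _ _ z Q r ⟩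
    product z (Q ^ 3) (suc m) * product (z * Q) (Q ^ 3) (suc m) * product (z * Q ^ 2) (Q ^ 3) (suc m) ∎
    where
    r = (Q ^ 3) ^ m
    Q³ᵐ : Q ^ (3 ℕ.* m) ≈ r
    Q³ᵐ = sym (^-assocʳ Q 3 m)

  difference-of-squares : ∀ u → (1# + u) * (1# + - u) ≈ 1# + - (u * u)
  difference-of-squares u = begin
    (1# + u) * (1# + - u)
      ≈⟨ solve 2 (λ u v → (con 1 :+ u) :* (con 1 :+ v) := con 1 :+ (u :+ v) :+ u :* v) refl u (- u) ⟩
    1# + (u + - u) + u * - u
      ≈⟨ +-cong (+-congˡ (-‿inverseʳ u)) (sym (-‿distribʳ-* u u)) ⟩
    1# + 0# + - (u * u)
      ≈⟨ +-congʳ (+-identityʳ 1#) ⟩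
    1# + - (u * u) ∎

  -- Factor by factor this is (1 + u)(1 - u) = 1 - u² with u = z Q^m.
  product-conj : ∀ z Q m → product z Q m * product (- z) Q m ≈ product (- (z ^ 2)) (Q ^ 2) m
  product-conj z Q zero    = *-identityˡ 1#
  product-conj z Q (suc m) = begin
    product z Q m * (1# + z * r) * (product (- z) Q m * (1# + - z * r))
      ≈⟨ *-congˡ (*-congˡ (+-congˡ (sym (-‿distribˡ-* z r)))) ⟩
    product z Q m * (1# + z * r) * (product (- z) Q m * (1# + - (z * r)))
      ≈⟨ solve 4 (λ a b c d → a :* b :* (c :* d) := a :* c :* (b :* d)) refl _ _ _ _ ⟩
    product z Q m * product (- z) Q m * ((1# + z * r) * (1# + - (z * r)))
      ≈⟨ *-cong (product-conj z Q m) (difference-of-squares (z * r)) ⟩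
    product (- (z ^ 2)) (Q ^ 2) m * (1# + - (z * r * (z * r)))
      ≈⟨ *-congˡ (+-congˡ (-‿cong (solve 2
           (λ z r → z :* r :* (z :* r) := z :* (z :* con 1) :* (r :* (r :* con 1))) refl z r))) ⟩
    product (- (z ^ 2)) (Q ^ 2) m * (1# + - (z ^ 2 * r ^ 2))
      ≈⟨ *-congˡ (+-congˡ (trans (-‿distribˡ-* _ _) (*-congˡ (trans (^-assocʳ Q m 2)
           (trans (reflexive (≡.cong (Q ^_) (ℕ.*-comm m 2))) (sym (^-assocʳ Q 2 m))))))) ⟩
    product (- (z ^ 2)) (Q ^ 2) (suc m) ∎
    where r = Q ^ m

  -- Gaussian binomial coefficients and the q-binomial theorem.

  -- The Gaussian binomial coefficient, given by its q-Pascal rule so that it makes sense in any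
  -- commutative ring; `gauss-factorial` recovers the usual quotient of factorials.
  gauss : Carrier → ℕ → ℕ → Carrier
  gauss Q n       zero    = 1#
  gauss Q zero    (suc k) = 0#
  gauss Q (suc n) (suc k) = gauss Q n k + Q ^ suc k * gauss Q n (suc k)

  gauss-vanish : ∀ Q {n k} → n ℕ.< k → gauss Q n k ≈ 0#
  gauss-vanish Q {zero}  (s≤s _)   = refl
  gauss-vanish Q {suc n} {suc k} (s≤s n<k) = trans
    (+-cong (gauss-vanish Q n<k) (trans (*-congˡ (gauss-vanish Q (ℕ.m<n⇒m<1+n n<k))) (zeroʳ _)))
    (+-identityˡ 0#)

  gauss-diagonal : ∀ Q n → gauss Q n n ≈ 1#
  gauss-diagonal Q zero    = refl
  gauss-diagonal Q (suc n) = trans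
    (+-cong (gauss-diagonal Q n) (trans (*-congˡ (gauss-vanish Q (ℕ.n<1+n n))) (zeroʳ _)))
    (+-identityʳ 1#)

  -- (Q;Q)ₘ
  factorial : Carrier → ℕ → Carrier
  factorial Q = product (- Q) Q

  factorial-suc : ∀ Q n → factorial Q (suc n) ≈ factorial Q n * (1# + - (Q ^ suc n))
  factorial-suc Q n = *-congˡ (+-congˡ (sym (-‿distribˡ-* Q (Q ^ n))))

  -- By the Pascal rule and induction, the two summands contribute 1 - u and u (1 - v) times the
  -- common factor `F`, where u = Q^(i+1) and v = Q^(j+1). These add up to 1 - u v, the last factor
  -- of the larger factorial.
  gauss-factorial : ∀ Q i j →
    gauss Q (i ℕ.+ j) i * (factorial Q i * factorial Q j) ≈ factorial Q (i ℕ.+ j)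
  gauss-factorial Q zero j = trans (*-identityˡ _) (*-identityˡ _)
  gauss-factorial Q (suc i) zero = begin
    gauss Q (suc i ℕ.+ 0) (suc i) * (factorial Q (suc i) * 1#)
      ≡⟨ ≡.cong (λ n → gauss Q n (suc i) * (factorial Q (suc i) * 1#)) (ℕ.+-identityʳ (suc i)) ⟩
    gauss Q (suc i) (suc i) * (factorial Q (suc i) * 1#)
      ≈⟨ *-cong (gauss-diagonal Q (suc i)) (*-identityʳ _) ⟩
    1# * factorial Q (suc i)
      ≈⟨ *-identityˡ _ ⟩
    factorial Q (suc i)
      ≡⟨ ≡.cong (factorial Q) (ℕ.+-identityʳ (suc i)) ⟨
    factorial Q (suc i ℕ.+ 0) ∎
  gauss-factorial Q (suc i) (suc j) = begin
    (gauss Q n i + u * gauss Q n (suc i)) * (factorial Q (suc i) * factorial Q (suc j))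
      ≈⟨ solve 5 (λ a b u p r → (a :+ u :* b) :* (p :* r) := a :* (p :* r) :+ u :* (b :* (p :* r))) refl _ _ u _ _ ⟩
    gauss Q n i * (factorial Q (suc i) * factorial Q (suc j))
      + u * (gauss Q n (suc i) * (factorial Q (suc i) * factorial Q (suc j)))
      ≈⟨ +-cong left right ⟩
    (1# + - u) * F + u * ((1# + - v) * F)
      ≈⟨ solve 4 (λ u u′ v′ F → (con 1 :+ u′) :* F :+ u :* ((con 1 :+ v′) :* F)
                   := F :* (con 1 :+ (u :+ u′) :+ u :* v′)) refl u (- u) (- v) F ⟩
    F * (1# + (u + - u) + u * - v)
      ≈⟨ *-congˡ (+-cong (trans (+-congˡ (-‿inverseʳ u)) (+-identityʳ 1#))
           (trans (sym (-‿distribʳ-* u v)) (-‿cong (sym (^-homo-* Q (suc i) (suc j)))))) ⟩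
    F * (1# + - (Q ^ (suc i ℕ.+ suc j)))
      ≈⟨ factorial-suc Q n ⟨
    factorial Q (suc i ℕ.+ suc j) ∎
    where
    n = i ℕ.+ suc j
    u = Q ^ suc i
    v = Q ^ suc j
    F = factorial Q n
    left : gauss Q n i * (factorial Q (suc i) * factorial Q (suc j)) ≈ (1# + - u) * F
    left = begin
      gauss Q n i * (factorial Q (suc i) * factorial Q (suc j))
        ≈⟨ *-congˡ (*-congʳ (factorial-suc Q i)) ⟩
      gauss Q n i * (factorial Q i * (1# + - u) * factorial Q (suc j))
        ≈⟨ solve 4 (λ a p w r → a :* (p :* w :* r) := w :* (a :* (p :* r))) refl _ _ _ _ ⟩
      (1# + - u) * (gauss Q n i * (factorial Q i * factorial Q (suc j)))
        ≈⟨ *-congˡ (gauss-factorial Q i (suc j)) ⟩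
      (1# + - u) * F ∎
    right : u * (gauss Q n (suc i) * (factorial Q (suc i) * factorial Q (suc j))) ≈ u * ((1# + - v) * F)
    right = *-congˡ (begin
      gauss Q n (suc i) * (factorial Q (suc i) * factorial Q (suc j))
        ≈⟨ *-congˡ (*-congˡ (factorial-suc Q j)) ⟩
      gauss Q n (suc i) * (factorial Q (suc i) * (factorial Q j * (1# + - v)))
        ≈⟨ solve 4 (λ a p r w → a :* (p :* (r :* w)) := w :* (a :* (p :* r))) refl _ _ _ _ ⟩
      (1# + - v) * (gauss Q n (suc i) * (factorial Q (suc i) * factorial Q j))
        ≡⟨ ≡.cong (λ m → (1# + - v) * (gauss Q m (suc i) * (factorial Q (suc i) * factorial Q j))) (ℕ.+-suc i j) ⟩
      (1# + - v) * (gauss Q (suc i ℕ.+ j) (suc i) * (factorial Q (suc i) * factorial Q j))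
        ≈⟨ *-congˡ (gauss-factorial Q (suc i) j) ⟩
      (1# + - v) * factorial Q (suc i ℕ.+ j)
        ≡⟨ ≡.cong (λ m → (1# + - v) * factorial Q m) (ℕ.+-suc i j) ⟨
      (1# + - v) * F ∎)

  -- The Pascal rule in summed form, for arbitrary weights. It is the induction step of both
  -- `q-binomial` and `finite-jtp`: there it only remains to see that the new factor turns the old
  -- weights into `U (suc k) + Q ^ k * U k`.
  gauss-sum : ∀ Q n (U : ℕ → Carrier) →
    ∑< (suc (suc n)) (λ k → gauss Q (suc n) k * U k)
      ≈ ∑< (suc n) (λ k → gauss Q n k * (U (suc k) + Q ^ k * U k))
  gauss-sum Q n U = begin
    1# * U 0 + ∑< (suc n) (λ k → (gauss Q n k + Q ^ suc k * gauss Q n (suc k)) * U (suc k))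
      ≈⟨ +-cong (sym (*-congˡ (*-identityˡ (U 0)))) (trans
           (∑<-cong (suc n) λ k _ → trans (distribʳ (U (suc k)) (gauss Q n k) _) (+-congˡ (rearrange (suc k))))
           (∑<-+ (suc n) B (A ∘ suc))) ⟩
    A 0 + (∑< (suc n) B + ∑< (suc n) (A ∘ suc))
      -- The top term contains `gauss Q n (suc n)`, which is zero; what is left of the shifted sum
      -- joins `A 0` to form the sum of `A`.
      ≈⟨ +-congˡ (+-congˡ (trans (∑<-last n (A ∘ suc)) (+-congˡ (trans
           (*-congʳ (gauss-vanish Q (ℕ.n<1+n n))) (zeroˡ _))))) ⟩
    A 0 + (∑< (suc n) B + (∑< n (A ∘ suc) + 0#))
      ≈⟨ solve 3 (λ a b c → a :+ (b :+ (c :+ con 0)) := b :+ (a :+ c)) refl _ _ _ ⟩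
    ∑< (suc n) B + ∑< (suc n) A
      ≈⟨ ∑<-+ (suc n) B A ⟨
    ∑< (suc n) (λ k → B k + A k)
      ≈⟨ ∑<-cong (suc n) (λ k _ → sym (distribˡ (gauss Q n k) (U (suc k)) (Q ^ k * U k))) ⟩
    ∑< (suc n) (λ k → gauss Q n k * (U (suc k) + Q ^ k * U k)) ∎
    where
    A B : ℕ → Carrier
    A k = gauss Q n k * (Q ^ k * U k)
    B k = gauss Q n k * U (suc k)
    rearrange : ∀ k → Q ^ k * gauss Q n k * U k ≈ A k
    rearrange k = solve 3 (λ r g u → r :* g :* u := g :* (r :* u)) refl _ _ _

  -- z^k Q^(k(k-1)/2)
  partialTheta : Carrier → Carrier → ℕ → Carrier
  partialTheta z Q zero    = 1#
  partialTheta z Q (suc k) = partialTheta z Q k * (z * Q ^ k)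

  partialTheta-* : ∀ z Q k → partialTheta (z * Q) Q k ≈ Q ^ k * partialTheta z Q k
  partialTheta-* z Q zero    = sym (*-identityˡ 1#)
  partialTheta-* z Q (suc k) = trans (*-congʳ (partialTheta-* z Q k))
    (solve 4 (λ p r z Q → r :* p :* (z :* Q :* r) := Q :* r :* (p :* (z :* r))) refl _ _ z Q)

  -- The induction peels off the first factor 1 + z. The remaining product has argument z Q, which
  -- multiplies the k-th weight by Q^k, and 1 + z then produces the two weights that `gauss-sum`
  -- expects.
  q-binomial : ∀ z Q n → product z Q n ≈ ∑< (suc n) (λ k → gauss Q n k * partialTheta z Q k)
  q-binomial z Q zero    = sym (trans (+-identityʳ _) (*-identityˡ 1#))
  q-binomial z Q (suc n) = begin
    product z Q (suc n)
      ≈⟨ product-head z Q n ⟩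
    (1# + z) * product (z * Q) Q n
      ≈⟨ *-congˡ (q-binomial (z * Q) Q n) ⟩
    (1# + z) * ∑< (suc n) (λ k → gauss Q n k * partialTheta (z * Q) Q k)
      ≈⟨ *-distribˡ-sum {suc n} (1# + z) (λ i → gauss Q n (toℕ i) * partialTheta (z * Q) Q (toℕ i)) ⟩
    ∑< (suc n) (λ k → (1# + z) * (gauss Q n k * partialTheta (z * Q) Q k))
      ≈⟨ ∑<-cong (suc n) (λ k _ → trans (*-congˡ (*-congˡ (partialTheta-* z Q k)))
           (solve 4 (λ z g r p → (con 1 :+ z) :* (g :* (r :* p)) := g :* (p :* (z :* r) :+ r :* p))
             refl z (gauss Q n k) _ _)) ⟩
    ∑< (suc n) (λ k → gauss Q n k * (partialTheta z Q (suc k) + Q ^ k * partialTheta z Q k))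
      ≈⟨ gauss-sum Q n (partialTheta z Q) ⟨
    ∑< (suc (suc n)) (λ k → gauss Q (suc n) k * partialTheta z Q k) ∎

  -- The Jacobi triple product in finite form.

  -- For x y = Q this is x^n Q^(n(n-1)/2) with n = i - k, written without
  -- negative exponents.
  theta : Carrier → Carrier → Carrier → ℕ → ℕ → Carrier
  theta x y Q zero    k       = partialTheta y Q k
  theta x y Q (suc i) zero    = partialTheta x Q (suc i)
  theta x y Q (suc i) (suc k) = theta x y Q i k

  theta-zeroʳ : ∀ x y Q i → theta x y Q i 0 ≡ partialTheta x Q i
  theta-zeroʳ x y Q zero    = ≡.refl
  theta-zeroʳ x y Q (suc i) = ≡.refl

  -- Raising the exponent n = i - k by one multiplies the term by x Q^n, and Q^k Q^n = Q^i. For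
  -- negative n the new x is absorbed by a factor y, through x y = Q.
  theta-suc : ∀ {x y Q} → x * y ≈ Q → ∀ i k →
              theta x y Q i k * (x * Q ^ i) ≈ Q ^ k * theta x y Q (suc i) k
  theta-suc {x} {y} {Q} xy≈Q zero    zero    = sym (*-identityˡ _)
  theta-suc {x} {y} {Q} xy≈Q zero    (suc k) = begin
    partialTheta y Q k * (y * Q ^ k) * (x * 1#)
      ≈⟨ solve 4 (λ p x y r → p :* (y :* r) :* (x :* con 1) := x :* y :* r :* p) refl _ x y _ ⟩
    x * y * Q ^ k * partialTheta y Q k
      ≈⟨ *-congʳ (*-congʳ xy≈Q) ⟩
    Q ^ suc k * partialTheta y Q k ∎
  theta-suc {x} {y} {Q} xy≈Q (suc i) zero    = sym (*-identityˡ _)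
  theta-suc {x} {y} {Q} xy≈Q (suc i) (suc k) = begin
    theta x y Q i k * (x * (Q * Q ^ i))
      ≈⟨ solve 4 (λ t x Q r → t :* (x :* (Q :* r)) := Q :* (t :* (x :* r))) refl _ x Q _ ⟩
    Q * (theta x y Q i k * (x * Q ^ i))
      ≈⟨ *-congˡ (theta-suc xy≈Q i k) ⟩
    Q * (Q ^ k * theta x y Q (suc i) k)
      ≈⟨ *-assoc _ _ _ ⟨
    Q ^ suc k * theta x y Q (suc i) k ∎

  -- Induction on a, starting from the q-binomial theorem for y. The factor 1 + x Q^a adds to each
  -- term its `theta-suc` partner, and `theta x y Q a k` is by definition
  -- `theta x y Q (suc a) (suc k)`, so `gauss-sum` applies.
  finite-jtp : ∀ {x y Q} → x * y ≈ Q → ∀ a b →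
    product x Q a * product y Q b ≈ ∑< (suc (a ℕ.+ b)) (λ k → gauss Q (a ℕ.+ b) k * theta x y Q a k)
  finite-jtp {x} {y} {Q} xy≈Q zero    b = trans (*-identityˡ _) (q-binomial y Q b)
  finite-jtp {x} {y} {Q} xy≈Q (suc a) b = begin
    product x Q a * (1# + x * Q ^ a) * product y Q b
      ≈⟨ solve 3 (λ p w r → p :* w :* r := p :* r :* w) refl _ _ _ ⟩
    product x Q a * product y Q b * (1# + x * Q ^ a)
      ≈⟨ *-congʳ (finite-jtp xy≈Q a b) ⟩
    ∑< (suc n) (λ k → gauss Q n k * theta x y Q a k) * (1# + x * Q ^ a)
      ≈⟨ *-distribʳ-sum {suc n} (1# + x * Q ^ a) (λ i → gauss Q n (toℕ i) * theta x y Q a (toℕ i)) ⟩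
    ∑< (suc n) (λ k → gauss Q n k * theta x y Q a k * (1# + x * Q ^ a))
      ≈⟨ ∑<-cong (suc n) (λ k _ → trans
           (solve 3 (λ g t u → g :* t :* (con 1 :+ u) := g :* (t :+ t :* u)) refl (gauss Q n k) _ _)
           (*-congˡ (+-congˡ (theta-suc xy≈Q a k)))) ⟩
    ∑< (suc n) (λ k → gauss Q n k * (theta x y Q (suc a) (suc k) + Q ^ k * theta x y Q (suc a) k))
      ≈⟨ gauss-sum Q n (theta x y Q (suc a)) ⟨
    ∑< (suc (suc n)) (λ k → gauss Q (suc n) k * theta x y Q (suc a) k) ∎
    where n = a ℕ.+ b

  -- Dissection of theta sums into even and odd terms.

  -- The exponents of Q agree because 2k(2k - 1)/2 = k + 4 k(k - 1)/2.
  partialTheta-double : ∀ z Q k → partialTheta z Q (2 ℕ.* k) ≈ partialTheta (z ^ 2 * Q) (Q ^ 4) k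
  partialTheta-double z Q zero    = refl
  partialTheta-double z Q (suc k) = begin
    partialTheta z Q (2 ℕ.* suc k)
      ≡⟨ ≡.cong (partialTheta z Q) (ℕ.*-suc 2 k) ⟩
    partialTheta z Q (2 ℕ.* k) * (z * r) * (z * (Q * r))
      ≈⟨ *-congʳ (*-congʳ (partialTheta-double z Q k)) ⟩
    partialTheta (z ^ 2 * Q) (Q ^ 4) k * (z * r) * (z * (Q * r))
      ≈⟨ solve 4 (λ p z Q r → p :* (z :* r) :* (z :* (Q :* r))
            := p :* (z :* (z :* con 1) :* Q :* (r :* (r :* con 1)))) refl _ z Q r ⟩
    partialTheta (z ^ 2 * Q) (Q ^ 4) k * (z ^ 2 * Q * r ^ 2)
      ≈⟨ *-congˡ (*-congˡ (trans (^-assocʳ Q (2 ℕ.* k) 2)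
           (trans (reflexive (≡.cong (Q ^_) exponent)) (sym (^-assocʳ Q 4 k))))) ⟩
    partialTheta (z ^ 2 * Q) (Q ^ 4) (suc k) ∎
    where
    r = Q ^ (2 ℕ.* k)
    exponent : 2 ℕ.* k ℕ.* 2 ≡ 4 ℕ.* k
    exponent = ≡.trans (ℕ.*-comm (2 ℕ.* k) 2) (≡.sym (ℕ.*-assoc 2 2 k))

  theta-double : ∀ x y Q i k → theta x y Q (2 ℕ.* i) (2 ℕ.* k) ≈ theta (x ^ 2 * Q) (y ^ 2 * Q) (Q ^ 4) i k
  theta-double x y Q zero    k       = partialTheta-double y Q k
  theta-double x y Q (suc i) zero    = partialTheta-double x Q (suc i)
  theta-double x y Q (suc i) (suc k) = trans
    (reflexive (≡.cong₂ (theta x y Q) (ℕ.*-suc 2 i) (ℕ.*-suc 2 k)))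
    (theta-double x y Q i k)

  partialTheta-cong : ∀ {z z′ Q Q′} k → z ≈ z′ → Q ≈ Q′ → partialTheta z Q k ≈ partialTheta z′ Q′ k
  partialTheta-cong zero    z≈ Q≈ = refl
  partialTheta-cong (suc k) z≈ Q≈ = *-cong (partialTheta-cong k z≈ Q≈) (*-cong z≈ (^-congˡ k Q≈))

  theta-cong : ∀ {x x′ y y′ Q Q′} i k → x ≈ x′ → y ≈ y′ → Q ≈ Q′ → theta x y Q i k ≈ theta x′ y′ Q′ i k
  theta-cong zero    k       x≈ y≈ Q≈ = partialTheta-cong k y≈ Q≈
  theta-cong (suc i) zero    x≈ y≈ Q≈ = partialTheta-cong (suc i) x≈ Q≈
  theta-cong (suc i) (suc k) x≈ y≈ Q≈ = theta-cong i k x≈ y≈ Q≈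

  neg-square : ∀ z → (- z) ^ 2 ≈ z ^ 2
  neg-square z = begin
    - z * (- z * 1#)   ≈⟨ *-congˡ (*-identityʳ _) ⟩
    - z * - z          ≈⟨ -‿distribˡ-* z (- z) ⟨
    - (z * - z)        ≈⟨ -‿cong (-‿distribʳ-* z z) ⟨
    - - (z * z)        ≈⟨ -‿involutive _ ⟩
    z * z              ≈⟨ *-congˡ (*-identityʳ z) ⟨
    z * (z * 1#)       ∎

  -- `theta-double` expresses the even terms through x² and y² alone, where the signs disappear.
  theta-neg-even : ∀ x y Q i k → theta (- x) (- y) Q (2 ℕ.* i) (2 ℕ.* k) ≈ theta x y Q (2 ℕ.* i) (2 ℕ.* k)
  theta-neg-even x y Q i k = begin
    theta (- x) (- y) Q (2 ℕ.* i) (2 ℕ.* k)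
      ≈⟨ theta-double (- x) (- y) Q i k ⟩
    theta ((- x) ^ 2 * Q) ((- y) ^ 2 * Q) (Q ^ 4) i k
      ≈⟨ theta-cong i k (*-congʳ (neg-square x)) (*-congʳ (neg-square y)) refl ⟩
    theta (x ^ 2 * Q) (y ^ 2 * Q) (Q ^ 4) i k
      ≈⟨ theta-double x y Q i k ⟨
    theta x y Q (2 ℕ.* i) (2 ℕ.* k) ∎

  partialTheta-neg-odd : ∀ z Q k →
    partialTheta z Q (suc (2 ℕ.* k)) + partialTheta (- z) Q (suc (2 ℕ.* k)) ≈ 0#
  partialTheta-neg-odd z Q k = begin
    p * (z * r) + partialTheta (- z) Q (2 ℕ.* k) * (- z * r)
      -- With first index 0, `theta` is `partialTheta` of its second argument, so this is the even
      -- case for `partialTheta`.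
      ≈⟨ +-congˡ (*-cong (theta-neg-even z z Q 0 k) (sym (-‿distribˡ-* z r))) ⟩
    p * (z * r) + p * - (z * r)
      ≈⟨ distribˡ _ _ _ ⟨
    p * (z * r + - (z * r))
      ≈⟨ *-congˡ (-‿inverseʳ _) ⟩
    p * 0#
      ≈⟨ zeroʳ p ⟩
    0# ∎
    where
    p = partialTheta z Q (2 ℕ.* k)
    r = Q ^ (2 ℕ.* k)

  -- The sign change contributes (-1)^(i-k) to a term with indices i and k; as the first index is
  -- even here, an odd second index gives -1. Both indices drop by two until a partial theta term in
  -- x or in y is left.
  theta-neg-odd : ∀ x y Q i k →
    theta x y Q (2 ℕ.* i) (suc (2 ℕ.* k)) + theta (- x) (- y) Q (2 ℕ.* i) (suc (2 ℕ.* k)) ≈ 0#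
  theta-neg-odd x y Q zero    k       = partialTheta-neg-odd y Q k
  theta-neg-odd x y Q (suc i) zero    = trans
    (reflexive (≡.cong₂ _+_ (peel x y) (peel (- x) (- y)))) (partialTheta-neg-odd x Q i)
    where
    peel : ∀ x y → theta x y Q (2 ℕ.* suc i) 1 ≡ partialTheta x Q (suc (2 ℕ.* i))
    peel x y = ≡.cong (λ n → theta x y Q n 1) (ℕ.*-suc 2 i)
  theta-neg-odd x y Q (suc i) (suc k) = trans
    (reflexive (≡.cong₂ (λ m n → theta x y Q m (suc n) + theta (- x) (- y) Q m (suc n)) (ℕ.*-suc 2 i) (ℕ.*-suc 2 k)))
    (theta-neg-odd x y Q i k)

  -- The exponents 2l - k run symmetrically from -2l to 2l. Odd ones cancel between the two sums;
  -- even ones are twice the exponents from -l to l, so they fill exactly the window of the sum at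
  -- length l.
  theta-dissection : ∀ x y Q l → let n = suc (2 ℕ.* l); S = ∑< n (theta (x ^ 2 * Q) (y ^ 2 * Q) (Q ^ 4) l) in
    ∑< (suc (2 ℕ.* (2 ℕ.* l))) (theta x y Q (2 ℕ.* l))
      + ∑< (suc (2 ℕ.* (2 ℕ.* l))) (theta (- x) (- y) Q (2 ℕ.* l)) ≈ S + S
  theta-dissection x y Q l = begin
    ∑< (suc (2 ℕ.* m)) (theta x y Q m) + ∑< (suc (2 ℕ.* m)) (theta (- x) (- y) Q m)
      ≈⟨ ∑<-+ (suc (2 ℕ.* m)) (theta x y Q m) (theta (- x) (- y) Q m) ⟨
    ∑< (suc (2 ℕ.* m)) g
      ≈⟨ ∑<-evens m g (theta-neg-odd x y Q l) ⟩
    ∑< (suc m) (λ k → g (2 ℕ.* k))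
      ≈⟨ ∑<-cong (suc m) (λ k _ → +-cong (theta-double x y Q l k)
           (trans (theta-neg-even x y Q l k) (theta-double x y Q l k))) ⟩
    ∑< (suc m) (λ k → t k + t k)
      ≈⟨ ∑<-+ (suc m) t t ⟩
    ∑< (suc m) t + ∑< (suc m) t ∎
    where
    m = 2 ℕ.* l
    g t : ℕ → Carrier
    g k = theta x y Q m k + theta (- x) (- y) Q m k
    t = theta (x ^ 2 * Q) (y ^ 2 * Q) (Q ^ 4) l

  -- Nilpotent arguments and the full triple product.

  *-cancelʳ : ∀ {e e⁻¹ a b} → e⁻¹ * e ≈ 1# → a * e ≈ b * e → a ≈ b
  *-cancelʳ {e} {e⁻¹} {a} {b} inverse ae≈be = begin
    a               ≈⟨ expand a ⟩
    a * e * e⁻¹     ≈⟨ *-congʳ ae≈be ⟩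
    b * e * e⁻¹     ≈⟨ expand b ⟨
    b               ∎
    where
    expand : ∀ a → a ≈ a * e * e⁻¹
    expand a = begin
      a               ≈⟨ *-identityʳ a ⟨
      a * 1#          ≈⟨ *-congˡ inverse ⟨
      a * (e⁻¹ * e)   ≈⟨ solve 3 (λ a i e → a :* (i :* e) := a :* e :* i) refl a e⁻¹ e ⟩
      a * e * e⁻¹     ∎

  ^-vanish : ∀ {z m n} → z ^ m ≈ 0# → m ℕ.≤ n → z ^ n ≈ 0#
  ^-vanish {z} {m} {n} zᵐ≈0 m≤n = begin
    z ^ n                    ≡⟨ ≡.cong (z ^_) (ℕ.m+[n∸m]≡n m≤n) ⟨
    z ^ (m ℕ.+ (n ∸ m))      ≈⟨ ^-homo-* z m (n ∸ m) ⟩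
    z ^ m * z ^ (n ∸ m)      ≈⟨ *-congʳ zᵐ≈0 ⟩
    0# * z ^ (n ∸ m)         ≈⟨ zeroˡ _ ⟩
    0#                       ∎

  neg-nilpotent : ∀ z m → z ^ m ≈ 0# → (- z) ^ m ≈ 0#
  neg-nilpotent z m zᵐ≈0 = begin
    (- z) ^ m              ≈⟨ ^-congˡ m (-1*x≈-x z) ⟨
    (- 1# * z) ^ m         ≈⟨ ^-distrib-* (- 1#) z m ⟩
    (- 1#) ^ m * z ^ m     ≈⟨ *-congˡ zᵐ≈0 ⟩
    (- 1#) ^ m * 0#        ≈⟨ zeroʳ _ ⟩
    0#                     ∎

  -- Each factor of index at least k is 1, its power of Q being zero.
  product-stable : ∀ z Q {k m} → Q ^ k ≈ 0# → k ℕ.≤ m → product z Q m ≈ product z Q k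
  product-stable z Q {k} {m} Qᵏ≈0 k≤m =
    ≡.subst (λ n → product z Q n ≈ product z Q k) (ℕ.m∸n+n≡m k≤m) (go (m ∸ k))
    where
    go : ∀ d → product z Q (d ℕ.+ k) ≈ product z Q k
    go zero    = refl
    go (suc d) = begin
      product z Q (d ℕ.+ k) * (1# + z * Q ^ (d ℕ.+ k))
        ≈⟨ *-cong (go d) (+-congˡ (*-congˡ (^-vanish {Q} Qᵏ≈0 (ℕ.m≤n+m k d)))) ⟩
      product z Q k * (1# + z * 0#)
        ≈⟨ solve 2 (λ p z → p :* (con 1 :+ z :* con 0) := p) refl _ z ⟩
      product z Q k ∎

  -- Already z^m divides the term, so the power of Q need not be examined.
  partialTheta-vanish : ∀ z Q {k m} → z ^ k ≈ 0# → k ℕ.≤ m → partialTheta z Q m ≈ 0#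
  partialTheta-vanish z Q {k} {m} zᵏ≈0 k≤m with divisible m
    where
    divisible : ∀ m → ∃ λ w → partialTheta z Q m ≈ z ^ m * w
    divisible zero    = 1# , sym (*-identityˡ 1#)
    divisible (suc m) with divisible m
    ... | w , eq = w * Q ^ m , trans (*-congʳ eq)
      (solve 4 (λ r w z s → r :* w :* (z :* s) := z :* r :* (w :* s)) refl _ w z _)
  ... | w , eq = trans eq (trans (*-congʳ (^-vanish {z} zᵏ≈0 k≤m)) (zeroˡ w))

  theta-shiftˡ : ∀ x y Q d k → theta x y Q (k ℕ.+ d) k ≡ partialTheta x Q d
  theta-shiftˡ x y Q d zero    = theta-zeroʳ x y Q d
  theta-shiftˡ x y Q d (suc k) = theta-shiftˡ x y Q d k

  theta-shiftʳ : ∀ x y Q d k → theta x y Q k (k ℕ.+ d) ≡ partialTheta y Q d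
  theta-shiftʳ x y Q d zero    = ≡.refl
  theta-shiftʳ x y Q d (suc k) = theta-shiftʳ x y Q d k

  module _ (K : ℕ) {x y Q e⁻¹ : Carrier} (xy≈Q : x * y ≈ Q) (xᴷ≈0 : x ^ K ≈ 0#) (yᴷ≈0 : y ^ K ≈ 0#)
    (inverse : e⁻¹ * factorial Q K ≈ 1#) {l : ℕ} (2K≤l : K ℕ.+ K ℕ.≤ l) where
    private
      e = factorial Q K

      factorial-stable : ∀ {m} → K ℕ.≤ m → factorial Q m ≈ e
      factorial-stable = product-stable (- Q) Q (begin
        Q ^ K           ≈⟨ ^-congˡ K xy≈Q ⟨
        (x * y) ^ K     ≈⟨ ^-distrib-* x y K ⟩
        x ^ K * y ^ K   ≈⟨ *-congʳ xᴷ≈0 ⟩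
        0# * y ^ K      ≈⟨ zeroˡ _ ⟩
        0#              ∎)

      -- All three factorials in `gauss-factorial` have stabilised at `e`, and one of the two on the
      -- left is cancelled by invertibility.
      gauss-limit : ∀ {k j} → K ℕ.≤ k → K ℕ.≤ j → gauss Q (k ℕ.+ j) k * e ≈ 1#
      gauss-limit {k} {j} K≤k K≤j = *-cancelʳ inverse (begin
        g * e * e                            ≈⟨ *-assoc g e e ⟩
        g * (e * e)                          ≈⟨ *-congˡ (*-cong (factorial-stable K≤k) (factorial-stable K≤j)) ⟨
        g * (factorial Q k * factorial Q j)  ≈⟨ gauss-factorial Q k j ⟩
        factorial Q (k ℕ.+ j)                ≈⟨ factorial-stable (ℕ.≤-trans K≤k (ℕ.m≤m+n k j)) ⟩
        e                                    ≈⟨ *-identityˡ e ⟨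
        1# * e                               ∎)
        where g = gauss Q (k ℕ.+ j) k

      -- The purpose of the bound 2K ≤ l: an index within K of an end of the range is at least K
      -- away from the centre l.
      far : ∀ {k} → k ℕ.≤ K → K ℕ.≤ l ∸ k
      far {k} k≤K = ℕ.≤-trans (ℕ.≤-reflexive (≡.sym (ℕ.m+n∸n≡m K k)))
        (ℕ.∸-monoˡ-≤ k (ℕ.≤-trans (ℕ.+-monoʳ-≤ K k≤K) 2K≤l))

      near : ∀ {k} → k ℕ.≤ K → k ℕ.≤ l
      near k≤K = ℕ.≤-trans k≤K (ℕ.≤-trans (ℕ.m≤m+n K K) 2K≤l)

      vanishing : ∀ g {t} → t ≈ 0# → g * t * e ≈ t
      vanishing g t≈0 = trans (*-congʳ (trans (*-congˡ t≈0) (zeroʳ g))) (trans (zeroˡ e) (sym t≈0))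

      -- If k and its complement j are both at least K, the Gaussian coefficient is inverse to `e`.
      -- Otherwise k lies near an end of the range, and the theta term contains a power of x or of y
      -- with exponent at least K, so both sides are zero.
      term : ∀ k j → k ℕ.+ j ≡ l ℕ.+ l → gauss Q (l ℕ.+ l) k * theta x y Q l k * e ≈ theta x y Q l k
      term k j k+j≡2l with K ℕ.≤? k | K ℕ.≤? j
      ... | yes K≤k | yes K≤j = begin
        gauss Q (l ℕ.+ l) k * t * e   ≡⟨ ≡.cong (λ n → gauss Q n k * t * e) k+j≡2l ⟨
        gauss Q (k ℕ.+ j) k * t * e   ≈⟨ solve 3 (λ g t e → g :* t :* e := g :* e :* t) refl _ t e ⟩
        gauss Q (k ℕ.+ j) k * e * t   ≈⟨ *-congʳ (gauss-limit K≤k K≤j) ⟩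
        1# * t                        ≈⟨ *-identityˡ t ⟩
        t                             ∎
        where t = theta x y Q l k
      ... | no K≰k | _ = vanishing _ (begin
        theta x y Q l k                  ≡⟨ ≡.cong (λ n → theta x y Q n k) (ℕ.m+[n∸m]≡n (near k≤K)) ⟨
        theta x y Q (k ℕ.+ (l ∸ k)) k    ≡⟨ theta-shiftˡ x y Q (l ∸ k) k ⟩
        partialTheta x Q (l ∸ k)         ≈⟨ partialTheta-vanish x Q xᴷ≈0 (far k≤K) ⟩
        0#                               ∎)
        where k≤K = ℕ.≰⇒≥ K≰k
      ... | yes _ | no K≰j = vanishing _ (begin
        theta x y Q l k                  ≡⟨ ≡.cong (theta x y Q l) k≡ ⟩
        theta x y Q l (l ℕ.+ (l ∸ j))    ≡⟨ theta-shiftʳ x y Q (l ∸ j) l ⟩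
        partialTheta y Q (l ∸ j)         ≈⟨ partialTheta-vanish y Q yᴷ≈0 (far j≤K) ⟩
        0#                               ∎)
        where
        j≤K = ℕ.≰⇒≥ K≰j
        k≡ : k ≡ l ℕ.+ (l ∸ j)
        k≡ = ≡.trans (≡.sym (ℕ.m+n∸n≡m k j))
          (≡.trans (≡.cong (_∸ j) k+j≡2l) (ℕ.+-∸-assoc l (near j≤K)))

    jacobi-triple-product :
      product x Q l * product y Q l * factorial Q K ≈ ∑< (suc (2 ℕ.* l)) (theta x y Q l)
    jacobi-triple-product = begin
      product x Q l * product y Q l * e
        ≈⟨ *-congʳ (finite-jtp xy≈Q l l) ⟩
      ∑< (suc (l ℕ.+ l)) (λ k → gauss Q (l ℕ.+ l) k * theta x y Q l k) * e
        ≈⟨ *-distribʳ-sum {suc (l ℕ.+ l)} e (λ i → gauss Q (l ℕ.+ l) (toℕ i) * theta x y Q l (toℕ i)) ⟩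
      ∑< (suc (l ℕ.+ l)) (λ k → gauss Q (l ℕ.+ l) k * theta x y Q l k * e)
        ≈⟨ ∑<-cong (suc (l ℕ.+ l)) (λ k k< → term k (l ℕ.+ l ∸ k) (ℕ.m+[n∸m]≡n (ℕ.≤-pred k<))) ⟩
      ∑< (suc (l ℕ.+ l)) (theta x y Q l)
        ≡⟨ ≡.cong (λ n → ∑< (suc (l ℕ.+ n)) (theta x y Q l)) (ℕ.+-identityʳ l) ⟨
      ∑< (suc (2 ℕ.* l)) (theta x y Q l) ∎

  -- Theta products as eta quotients.

  -- With q^K = 0, E n is the infinite product (qⁿ;qⁿ)∞.
  module EtaQuotients (q : Carrier) (K : ℕ) (q^K≈0 : q ^ K ≈ 0#)
    (invertible : ∀ n .{{_ : NonZero n}} → ∃ λ e → e * factorial (q ^ n) K ≈ 1#)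
    where

    ^-nilpotent : ∀ n .{{_ : NonZero n}} → (q ^ n) ^ K ≈ 0#
    ^-nilpotent n = trans (^-assocʳ q n K) (^-vanish {q} q^K≈0 (ℕ.m≤n*m K n))

    -- In Pochhammer notation these are (-q^r;q^s)ₘ and (q^r;q^s)ₘ.
    P N : ℕ → ℕ → ℕ → Carrier
    P r s = product (q ^ r) (q ^ s)
    N r s = product (- (q ^ r)) (q ^ s)

    E : ℕ → Carrier
    E n = N n n K

    E-stable : ∀ n .{{_ : NonZero n}} {m} → K ℕ.≤ m → N n n m ≈ E n
    E-stable n = product-stable (- (q ^ n)) (q ^ n) (^-nilpotent n)

    neg-shift : ∀ r s → - (q ^ r) * q ^ s ≈ - (q ^ (r ℕ.+ s))
    neg-shift r s = trans (sym (-‿distribˡ-* _ _)) (-‿cong (sym (^-homo-* q r s)))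

    N-split₂ : ∀ n m → N n n (2 ℕ.* m) ≈ N n (n ℕ.* 2) m * N (n ℕ.+ n) (n ℕ.* 2) m
    N-split₂ n m = trans (product-split₂ _ _ m)
      (*-cong (product-cong m refl (^-assocʳ q n 2)) (product-cong m (neg-shift n n) (^-assocʳ q n 2)))

    P-split₃ : ∀ r s m → P r s (3 ℕ.* m) ≈
      P r (s ℕ.* 3) m * P (r ℕ.+ s) (s ℕ.* 3) m * P (r ℕ.+ s ℕ.* 2) (s ℕ.* 3) m
    P-split₃ r s m = trans (product-split₃ _ _ m) (*-cong (*-cong
      (product-cong m refl Q≈)
      (product-cong m (sym (^-homo-* q r s)) Q≈))
      (product-cong m (trans (*-congˡ (^-assocʳ q s 2)) (sym (^-homo-* q r (s ℕ.* 2)))) Q≈))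
      where Q≈ = ^-assocʳ q s 3

    N-split₃ : ∀ r s m → N r s (3 ℕ.* m) ≈
      N r (s ℕ.* 3) m * N (r ℕ.+ s) (s ℕ.* 3) m * N (r ℕ.+ s ℕ.* 2) (s ℕ.* 3) m
    N-split₃ r s m = trans (product-split₃ _ _ m) (*-cong (*-cong
      (product-cong m refl Q≈)
      (product-cong m (neg-shift r s) Q≈))
      (product-cong m (trans (*-congˡ (^-assocʳ q s 2)) (neg-shift r (s ℕ.* 2))) Q≈))
      where Q≈ = ^-assocʳ q s 3

    P*N : ∀ r s m → P r s m * N r s m ≈ N (r ℕ.* 2) (s ℕ.* 2) m
    P*N r s m = trans (product-conj (q ^ r) (q ^ s) m)
      (product-cong m (-‿cong (^-assocʳ q r 2)) (^-assocʳ q s 2))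

    module _ {m : ℕ} (K≤m : K ℕ.≤ m) where
      K≤2m : K ℕ.≤ 2 ℕ.* m
      K≤2m = ℕ.≤-trans K≤m (ℕ.m≤n*m m 2)

      -- This is (qⁿ;q²ⁿ)∞ = fₙ / f₂ₙ: the multiples of n are split into odd and even ones. Lengths
      -- m and 2m both count as infinite, being at least K.
      E-odd : ∀ n .{{_ : NonZero n}} → N n (n ℕ.* 2) m * E (n ℕ.* 2) ≈ E n
      E-odd n = begin
        N n (n ℕ.* 2) m * E (n ℕ.* 2)
          ≈⟨ *-congˡ (E-stable (n ℕ.* 2) {{ℕ.m*n≢0 n 2}} K≤m) ⟨
        N n (n ℕ.* 2) m * N (n ℕ.* 2) (n ℕ.* 2) m
          ≡⟨ ≡.cong (λ r → N n (n ℕ.* 2) m * N r (n ℕ.* 2) m)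
               (≡.trans (ℕ.*-comm n 2) (≡.cong (n ℕ.+_) (ℕ.+-identityʳ n))) ⟩
        N n (n ℕ.* 2) m * N (n ℕ.+ n) (n ℕ.* 2) m
          ≈⟨ N-split₂ n m ⟨
        N n n (2 ℕ.* m)
          ≈⟨ E-stable n K≤2m ⟩
        E n ∎

      -- This is (-qⁿ;q²ⁿ)∞ = f₂ₙ² / (fₙ f₄ₙ), from `P*N` and `E-odd` at n and at 2n.
      P-odd : ∀ n .{{_ : NonZero n}} →
        P n (n ℕ.* 2) m * (E n * E (n ℕ.* 2 ℕ.* 2)) ≈ E (n ℕ.* 2) * E (n ℕ.* 2)
      P-odd n = begin
        P n 2n m * (E n * E (2n ℕ.* 2))
          ≈⟨ *-congˡ (*-congʳ (E-odd n)) ⟨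
        P n 2n m * (N n 2n m * E 2n * E (2n ℕ.* 2))
          ≈⟨ solve 4 (λ p n e f → p :* (n :* e :* f) := p :* n :* f :* e) refl _ _ _ _ ⟩
        P n 2n m * N n 2n m * E (2n ℕ.* 2) * E 2n
          ≈⟨ *-congʳ (*-congʳ (P*N n 2n m)) ⟩
        N 2n (2n ℕ.* 2) m * E (2n ℕ.* 2) * E 2n
          ≈⟨ *-congʳ (E-odd 2n {{ℕ.m*n≢0 n 2}}) ⟩
        E 2n * E 2n ∎
        where 2n = n ℕ.* 2

      -- This is (-qⁿ;qⁿ)∞ = f₂ₙ / fₙ.
      P-even : ∀ n .{{_ : NonZero n}} → P n n m * E n ≈ E (n ℕ.* 2)
      P-even n = begin
        P n n m * E n
          ≈⟨ *-congˡ (E-stable n K≤m) ⟨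
        P n n m * N n n m
          ≈⟨ P*N n n m ⟩
        N (n ℕ.* 2) (n ℕ.* 2) m
          ≈⟨ E-stable (n ℕ.* 2) {{ℕ.m*n≢0 n 2}} K≤m ⟩
        E (n ℕ.* 2) ∎

    module _ {m : ℕ} (K≤m : K ℕ.≤ m) where
      private
        K≤3m : K ℕ.≤ 3 ℕ.* m
        K≤3m = ℕ.≤-trans K≤m (ℕ.m≤n*m m 3)

      -- Modulo 6 the odd exponents fall into the classes 1, 3 and 5, so the product over 1 and 5 is
      -- (-q;q²)∞ divided by (-q³;q⁶)∞, and `P-odd` evaluates both.
      P₁₆P₅₆ : P 1 6 m * P 5 6 m * E 6 * (E 1 * E 4 * E 6) ≈ E 2 * E 2 * E 3 * E 12
      P₁₆P₅₆ with invertible 6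
      ... | _ , inverse = *-cancelʳ inverse (begin
        P 1 6 m * P 5 6 m * E 6 * (E 1 * E 4 * E 6) * E 6
          ≈⟨ solve 5 (λ a b e₁ e₄ e₆ → a :* b :* e₆ :* (e₁ :* e₄ :* e₆) :* e₆
               := a :* b :* e₁ :* e₄ :* e₆ :* (e₆ :* e₆)) refl (P 1 6 m) (P 5 6 m) (E 1) (E 4) (E 6) ⟩
        P 1 6 m * P 5 6 m * E 1 * E 4 * E 6 * (E 6 * E 6)
          -- The extra factor `E 6`, cancelled at the end, makes a square available here, and the
          -- square supplies the missing class 3.
          ≈⟨ *-congˡ (P-odd K≤m 3) ⟨
        P 1 6 m * P 5 6 m * E 1 * E 4 * E 6 * (P 3 6 m * (E 3 * E 12))
          ≈⟨ solve 8 (λ a b c e₁ e₃ e₄ e₆ e₁₂ → a :* b :* e₁ :* e₄ :* e₆ :* (c :* (e₃ :* e₁₂))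
               := a :* c :* b :* (e₁ :* e₄) :* (e₃ :* e₁₂ :* e₆)) refl
               (P 1 6 m) (P 5 6 m) (P 3 6 m) (E 1) (E 3) (E 4) (E 6) (E 12) ⟩
        P 1 6 m * P 3 6 m * P 5 6 m * (E 1 * E 4) * (E 3 * E 12 * E 6)
          ≈⟨ *-congʳ (*-congʳ (P-split₃ 1 2 m)) ⟨
        P 1 2 (3 ℕ.* m) * (E 1 * E 4) * (E 3 * E 12 * E 6)
          ≈⟨ *-congʳ (P-odd K≤3m 1) ⟩
        E 2 * E 2 * (E 3 * E 12 * E 6)
          ≈⟨ solve 4 (λ e₂ e₃ e₆ e₁₂ → e₂ :* e₂ :* (e₃ :* e₁₂ :* e₆) := e₂ :* e₂ :* e₃ :* e₁₂ :* e₆)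
               refl (E 2) (E 3) (E 6) (E 12) ⟩
        E 2 * E 2 * E 3 * E 12 * E 6 ∎)

      -- The same completion to all odd exponents; the class 3 is now taken out of `E 3`.
      N₁₆N₅₆ : N 1 6 m * N 5 6 m * E 6 * (E 2 * E 3) ≈ E 1 * E 6 * E 6
      N₁₆N₅₆ = begin
        N 1 6 m * N 5 6 m * E 6 * (E 2 * E 3)
          ≈⟨ *-congˡ (*-congˡ (E-odd K≤m 3)) ⟨
        N 1 6 m * N 5 6 m * E 6 * (E 2 * (N 3 6 m * E 6))
          ≈⟨ solve 5 (λ a b c e₂ e₆ → a :* b :* e₆ :* (e₂ :* (c :* e₆)) := a :* c :* b :* e₂ :* (e₆ :* e₆))
               refl (N 1 6 m) (N 5 6 m) (N 3 6 m) (E 2) (E 6) ⟩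
        N 1 6 m * N 3 6 m * N 5 6 m * E 2 * (E 6 * E 6)
          ≈⟨ *-congʳ (*-congʳ (N-split₃ 1 2 m)) ⟨
        N 1 2 (3 ℕ.* m) * E 2 * (E 6 * E 6)
          ≈⟨ *-congʳ (E-odd K≤3m 1) ⟩
        E 1 * (E 6 * E 6)
          ≈⟨ *-assoc _ _ _ ⟨
        E 1 * E 6 * E 6 ∎

      -- The classes 8 and 16 modulo 24 are completed to all multiples of 8; the class 24 is taken
      -- out of `E 48`.
      P₈P₁₆ : P 8 24 m * P 16 24 m * E 24 * (E 8 * E 48) ≈ E 16 * E 24 * E 24
      P₈P₁₆ = begin
        P 8 24 m * P 16 24 m * E 24 * (E 8 * E 48)
          ≈⟨ *-congˡ (*-congˡ (P-even K≤m 24)) ⟨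
        P 8 24 m * P 16 24 m * E 24 * (E 8 * (P 24 24 m * E 24))
          ≈⟨ solve 5 (λ a b c e₈ e₂₄ → a :* b :* e₂₄ :* (e₈ :* (c :* e₂₄)) := a :* b :* c :* e₈ :* (e₂₄ :* e₂₄))
               refl (P 8 24 m) (P 16 24 m) (P 24 24 m) (E 8) (E 24) ⟩
        P 8 24 m * P 16 24 m * P 24 24 m * E 8 * (E 24 * E 24)
          ≈⟨ *-congʳ (*-congʳ (P-split₃ 8 8 m)) ⟨
        P 8 8 (3 ℕ.* m) * E 8 * (E 24 * E 24)
          ≈⟨ *-congʳ (P-even K≤3m 8) ⟩
        E 16 * (E 24 * E 24)
          ≈⟨ *-assoc _ _ _ ⟨
        E 16 * E 24 * E 24 ∎

    -- The triple product is applied at length 2l with base q⁶ for both signs, and backwards at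
    -- length l with base q²⁴ after the dissection.
    even-part : ∀ {l} → K ℕ.+ K ℕ.≤ l → let m = 2 ℕ.* l; B = P 8 24 l * P 16 24 l * E 24 in
      P 1 6 m * P 5 6 m * E 6 + N 1 6 m * N 5 6 m * E 6 ≈ B + B
    even-part {l} 2K≤l with invertible 6 | invertible 24
    ... | _ , inverse₆ | _ , inverse₂₄ = begin
      P 1 6 m * P 5 6 m * E 6 + N 1 6 m * N 5 6 m * E 6
        ≈⟨ +-cong
             (jacobi-triple-product K xy (^-nilpotent 1) (^-nilpotent 5) inverse₆ 2K≤m)
             (jacobi-triple-product K (trans neg-neg xy) (neg-nilpotent x K (^-nilpotent 1))
               (neg-nilpotent y K (^-nilpotent 5)) inverse₆ 2K≤m) ⟩
      ∑< (suc (2 ℕ.* m)) (theta x y Q m) + ∑< (suc (2 ℕ.* m)) (theta (- x) (- y) Q m)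
        ≈⟨ theta-dissection x y Q l ⟩
      ∑< (suc m) (theta (x ^ 2 * Q) (y ^ 2 * Q) (Q ^ 4) l) + ∑< (suc m) (theta (x ^ 2 * Q) (y ^ 2 * Q) (Q ^ 4) l)
        ≈⟨ +-cong B≈ B≈ ⟩
      B + B ∎
      where
      m = 2 ℕ.* l
      x = q ^ 1
      y = q ^ 5
      Q = q ^ 6
      B = P 8 24 l * P 16 24 l * E 24
      2K≤m : K ℕ.+ K ℕ.≤ m
      2K≤m = ℕ.≤-trans 2K≤l (ℕ.m≤n*m l 2)
      xy : x * y ≈ Q
      xy = sym (^-homo-* q 1 5)
      neg-neg : - x * - y ≈ x * y
      neg-neg = trans (sym (-‿distribˡ-* x (- y)))
        (trans (-‿cong (sym (-‿distribʳ-* x y))) (-‿involutive (x * y)))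
      square : ∀ n → (q ^ n) ^ 2 * Q ≈ q ^ (n ℕ.* 2 ℕ.+ 6)
      square n = trans (*-congʳ (^-assocʳ q n 2)) (sym (^-homo-* q (n ℕ.* 2) 6))
      B≈ : ∑< (suc m) (theta (x ^ 2 * Q) (y ^ 2 * Q) (Q ^ 4) l) ≈ B
      B≈ = begin
        ∑< (suc m) (theta (x ^ 2 * Q) (y ^ 2 * Q) (Q ^ 4) l)
          -- The new parameters are x² Q = q^(2+6), y² Q = q^(10+6) and Q⁴ = q²⁴.
          ≈⟨ ∑<-cong (suc m) (λ k _ → theta-cong l k (square 1) (square 5) (^-assocʳ q 6 4)) ⟩
        ∑< (suc m) (theta (q ^ 8) (q ^ 16) (q ^ 24) l)
          ≈⟨ jacobi-triple-product K (sym (^-homo-* q 8 16)) (^-nilpotent 8) (^-nilpotent 16) inverse₂₄ 2K≤l ⟨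
        B ∎

    -- The three quotients enter through their defining equations, so that no inverses appear in the
    -- computation. Multiplied by f₃ f₆, they become f₁ times `A′`, `A` and `B` respectively.
    eta-identity : ∀ {X Y Z} →
      X * (E 2 * (E 3 * E 3)) ≈ E 1 * E 1 * E 6 →
      Y * (E 4 * (E 6 * E 6)) ≈ E 2 * E 2 * E 12 →
      Z * (E 3 * E 6 * E 8 * E 48) ≈ E 1 * E 16 * (E 24 * E 24) →
      X + Y ≈ Z + Z
    eta-identity {X} {Y} {Z} X-eq Y-eq Z-eq = cancel 6 (cancel 3 (begin
      (X + Y) * E 6 * E 3
        ≈⟨ solve 4 (λ x y e₃ e₆ → (x :+ y) :* e₆ :* e₃ := y :* e₃ :* e₆ :+ x :* e₃ :* e₆) refl X Y (E 3) (E 6) ⟩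
      Y * E 3 * E 6 + X * E 3 * E 6
        ≈⟨ +-cong Y≈ X≈ ⟩
      A * E 1 + A′ * E 1
        ≈⟨ distribʳ (E 1) A A′ ⟨
      (A + A′) * E 1
        -- The length `l` is K + K, the least one that `even-part` admits.
        ≈⟨ *-congʳ (even-part ℕ.≤-refl) ⟩
      (B + B) * E 1
        ≈⟨ distribʳ (E 1) B B ⟩
      B * E 1 + B * E 1
        ≈⟨ +-cong Z≈ Z≈ ⟨
      Z * E 3 * E 6 + Z * E 3 * E 6
        ≈⟨ solve 3 (λ z e₃ e₆ → z :* e₃ :* e₆ :+ z :* e₃ :* e₆ := (z :+ z) :* e₆ :* e₃)
               refl Z (E 3) (E 6) ⟩
      (Z + Z) * E 6 * E 3 ∎))
      where
      l = K ℕ.+ K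
      A = P 1 6 (2 ℕ.* l) * P 5 6 (2 ℕ.* l) * E 6
      A′ = N 1 6 (2 ℕ.* l) * N 5 6 (2 ℕ.* l) * E 6
      B = P 8 24 l * P 16 24 l * E 24
      K≤l : K ℕ.≤ l
      K≤l = ℕ.m≤m+n K K
      K≤2l : K ℕ.≤ 2 ℕ.* l
      K≤2l = ℕ.≤-trans K≤l (ℕ.m≤n*m l 2)

      cancel : ∀ n .{{_ : NonZero n}} {a b} → a * E n ≈ b * E n → a ≈ b
      cancel n with invertible n
      ... | _ , inverse = *-cancelʳ inverse

      X≈ : X * E 3 * E 6 ≈ A′ * E 1
      X≈ = cancel 2 (cancel 3 (begin
        X * E 3 * E 6 * E 2 * E 3
          ≈⟨ solve 4 (λ x e₂ e₃ e₆ → x :* e₃ :* e₆ :* e₂ :* e₃ := x :* (e₂ :* (e₃ :* e₃)) :* e₆)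
               refl X (E 2) (E 3) (E 6) ⟩
        X * (E 2 * (E 3 * E 3)) * E 6
          ≈⟨ *-congʳ X-eq ⟩
        E 1 * E 1 * E 6 * E 6
          ≈⟨ solve 2 (λ e₁ e₆ → e₁ :* e₁ :* e₆ :* e₆ := e₁ :* e₆ :* e₆ :* e₁)
               refl (E 1) (E 6) ⟩
        E 1 * E 6 * E 6 * E 1
          ≈⟨ *-congʳ (N₁₆N₅₆ K≤2l) ⟨
        A′ * (E 2 * E 3) * E 1
          ≈⟨ solve 4 (λ a e₁ e₂ e₃ → a :* (e₂ :* e₃) :* e₁ := a :* e₁ :* e₂ :* e₃)
               refl A′ (E 1) (E 2) (E 3) ⟩
        A′ * E 1 * E 2 * E 3 ∎))

      Y≈ : Y * E 3 * E 6 ≈ A * E 1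
      Y≈ = cancel 4 (cancel 6 (begin
        Y * E 3 * E 6 * E 4 * E 6
          ≈⟨ solve 4 (λ y e₃ e₄ e₆ → y :* e₃ :* e₆ :* e₄ :* e₆ := y :* (e₄ :* (e₆ :* e₆)) :* e₃)
               refl Y (E 3) (E 4) (E 6) ⟩
        Y * (E 4 * (E 6 * E 6)) * E 3
          ≈⟨ *-congʳ Y-eq ⟩
        E 2 * E 2 * E 12 * E 3
          ≈⟨ solve 3 (λ e₂ e₃ e₁₂ → e₂ :* e₂ :* e₁₂ :* e₃ := e₂ :* e₂ :* e₃ :* e₁₂)
               refl (E 2) (E 3) (E 12) ⟩
        E 2 * E 2 * E 3 * E 12
          ≈⟨ P₁₆P₅₆ K≤2l ⟨
        A * (E 1 * E 4 * E 6)
          ≈⟨ solve 4 (λ a e₁ e₄ e₆ → a :* (e₁ :* e₄ :* e₆) := a :* e₁ :* e₄ :* e₆)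
               refl A (E 1) (E 4) (E 6) ⟩
        A * E 1 * E 4 * E 6 ∎))

      Z≈ : Z * E 3 * E 6 ≈ B * E 1
      Z≈ = cancel 8 (cancel 48 (begin
        Z * E 3 * E 6 * E 8 * E 48
          ≈⟨ solve 5 (λ z e₃ e₆ e₈ e₄₈ → z :* e₃ :* e₆ :* e₈ :* e₄₈ := z :* (e₃ :* e₆ :* e₈ :* e₄₈))
               refl Z (E 3) (E 6) (E 8) (E 48) ⟩
        Z * (E 3 * E 6 * E 8 * E 48)
          ≈⟨ Z-eq ⟩
        E 1 * E 16 * (E 24 * E 24)
          ≈⟨ solve 3 (λ e₁ e₁₆ e₂₄ → e₁ :* e₁₆ :* (e₂₄ :* e₂₄) := e₁₆ :* e₂₄ :* e₂₄ :* e₁)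
               refl (E 1) (E 16) (E 24) ⟩
        E 16 * E 24 * E 24 * E 1
          ≈⟨ *-congʳ (P₈P₁₆ K≤l) ⟨
        B * (E 8 * E 48) * E 1
          ≈⟨ solve 4 (λ b e₁ e₈ e₄₈ → b :* (e₈ :* e₄₈) :* e₁ := b :* e₁ :* e₈ :* e₄₈)
               refl B (E 1) (E 8) (E 48) ⟩
        B * E 1 * E 8 * E 48 ∎))

-- Formal power series modulo q^K

open import Defs
open import Algebra.Properties.CommutativeMonoid.Sum ℤ.+-0-commutativeMonoid using (sum-cong-≗)
open +-*-Solver using (solve; _:*_; _:+_; _:=_; con)

-- Ring laws of the convolution product.

-- By definition the convolution sum splits off the head of the left factor; this form splits off
-- the head of the right one, as commutativity requires.
*-suc : ∀ a b n → (a * b) (suc n) ≡ a (suc n) ℤ.* b 0 ℤ.+ (a * (b ∘ suc)) n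
*-suc a b zero    = solve 4
  (λ a₀ a₁ b₀ b₁ → a₀ :* b₁ :+ (a₁ :* b₀ :+ con 0ℤ) := a₁ :* b₀ :+ (a₀ :* b₁ :+ con 0ℤ))
  ≡.refl (a 0) (a 1) (b 0) (b 1)
*-suc a b (suc n) = ≡.trans
  (≡.cong (λ t → a 0 ℤ.* b (suc (suc n)) ℤ.+ t) (*-suc (a ∘ suc) b n))
  (solve 3 (λ x y z → x :+ (y :+ z) := y :+ (x :+ z)) ≡.refl
    (a 0 ℤ.* b (suc (suc n))) (a (suc (suc n)) ℤ.* b 0) (((a ∘ suc) * (b ∘ suc)) n))

*-comm : ∀ a b → a * b ≗ b * a
*-comm a b zero    = ≡.cong (ℤ._+ 0ℤ) (ℤ.*-comm (a 0) (b 0))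
*-comm a b (suc n) = ≡.trans
  (≡.cong₂ ℤ._+_ (ℤ.*-comm (a 0) (b (suc n))) (*-comm (a ∘ suc) b n))
  (≡.sym (*-suc b a n))

*-distribʳ-+ : ∀ c a b → (a + b) * c ≗ a * c + b * c
*-distribʳ-+ c a b zero    = solve 3
  (λ a b c → (a :+ b) :* c :+ con 0ℤ := a :* c :+ con 0ℤ :+ (b :* c :+ con 0ℤ))
  ≡.refl (a 0) (b 0) (c 0)
*-distribʳ-+ c a b (suc n) = ≡.trans
  (≡.cong (λ t → (a 0 ℤ.+ b 0) ℤ.* c (suc n) ℤ.+ t) (*-distribʳ-+ c (a ∘ suc) (b ∘ suc) n))
  (solve 5 (λ a b c x y → (a :+ b) :* c :+ (x :+ y) := a :* c :+ x :+ (b :* c :+ y)) ≡.refl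
    (a 0) (b 0) (c (suc n)) (((a ∘ suc) * c) n) (((b ∘ suc) * c) n))

*-assoc-· : ∀ k a b → (k · a) * b ≗ k · (a * b)
*-assoc-· k a b zero    = solve 3 (λ k a b → k :* a :* b :+ con 0ℤ := k :* (a :* b :+ con 0ℤ)) ≡.refl k (a 0) (b 0)
*-assoc-· k a b (suc n) = ≡.trans
  (≡.cong (λ t → k ℤ.* a 0 ℤ.* b (suc n) ℤ.+ t) (*-assoc-· k (a ∘ suc) b n))
  (solve 4 (λ k a b x → k :* a :* b :+ k :* x := k :* (a :* b :+ x)) ≡.refl k (a 0) (b (suc n)) (((a ∘ suc) * b) n))

-- This locality of the product makes congruence modulo q^K compatible with multiplication.
*-cong-≤ : ∀ {a a′ b b′} n → (∀ {i} → i ℕ.≤ n → a i ≡ a′ i) → (∀ {i} → i ℕ.≤ n → b i ≡ b′ i) →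
  (a * b) n ≡ (a′ * b′) n
*-cong-≤ n a≡ b≡ = sum-cong-≗ {suc n} λ i →
  ≡.cong₂ ℤ._*_ (a≡ (ℕ.≤-pred (Fin.toℕ<n i))) (b≡ (ℕ.m∸n≤m n (toℕ i)))

-- The tail of `a * b` is by definition `a 0 · (b ∘ suc) + (a ∘ suc) * b`, so distributivity and
-- `*-assoc-·` reduce the claim to the induction hypothesis for `a ∘ suc`.
*-assoc : ∀ a b c → (a * b) * c ≗ a * (b * c)
*-assoc a b c zero    = solve 3
  (λ a b c → (a :* b :+ con 0ℤ) :* c :+ con 0ℤ := a :* (b :* c :+ con 0ℤ) :+ con 0ℤ)
  ≡.refl (a 0) (b 0) (c 0)
*-assoc a b c (suc n) = begin
  (a 0 ℤ.* b 0 ℤ.+ 0ℤ) ℤ.* c (suc n) ℤ.+ ((a 0 · (b ∘ suc) + (a ∘ suc) * b) * c) n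
    ≡⟨ ≡.cong (λ t → h ℤ.+ t) (*-distribʳ-+ c (a 0 · (b ∘ suc)) ((a ∘ suc) * b) n) ⟩
  h ℤ.+ (((a 0 · (b ∘ suc)) * c) n ℤ.+ (((a ∘ suc) * b) * c) n)
    ≡⟨ ≡.cong (λ t → h ℤ.+ t) (≡.cong₂ ℤ._+_ (*-assoc-· (a 0) (b ∘ suc) c n) (*-assoc (a ∘ suc) b c n)) ⟩
  h ℤ.+ (a 0 ℤ.* ((b ∘ suc) * c) n ℤ.+ ((a ∘ suc) * (b * c)) n)
    ≡⟨ solve 5 (λ a b c x y → (a :* b :+ con 0ℤ) :* c :+ (a :* x :+ y) := a :* (b :* c :+ x) :+ y) ≡.refl
         (a 0) (b 0) (c (suc n)) (((b ∘ suc) * c) n) (((a ∘ suc) * (b * c)) n) ⟩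
  (a * (b * c)) (suc n) ∎
  where
  open ≡.≡-Reasoning
  h = (a 0 ℤ.* b 0 ℤ.+ 0ℤ) ℤ.* c (suc n)

*-zeroˡ : ∀ b → (λ _ → 0ℤ) * b ≗ (λ _ → 0ℤ)
*-zeroˡ b zero    = ≡.refl
*-zeroˡ b (suc n) = ≡.trans (ℤ.+-identityˡ _) (*-zeroˡ b n)

*-identityˡ : ∀ a → one * a ≗ a
*-identityˡ a zero    = ≡.trans (ℤ.+-identityʳ _) (ℤ.*-identityˡ (a 0))
*-identityˡ a (suc n) = ≡.trans
  (≡.cong₂ ℤ._+_ (ℤ.*-identityˡ (a (suc n))) (*-zeroˡ a n)) (ℤ.+-identityʳ _)

q^-+ : ∀ m n → q^ m * q^ n ≗ q^ (m ℕ.+ n)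
q^-+ zero    n i       = *-identityˡ (q^ n) i
q^-+ (suc m) n zero    = ≡.refl
q^-+ (suc m) n (suc i) = ≡.trans (ℤ.+-identityˡ _) (q^-+ m n i)

q^-vanish : ∀ {i m} → i ℕ.< m → (q^ m) i ≡ 0ℤ
q^-vanish {zero}  {suc m} _         = ≡.refl
q^-vanish {suc i} {suc m} (s≤s i<m) = q^-vanish i<m

-- Congruence modulo q^K; a record so that a and b can be inferred.
record Agree (K : ℕ) (a b : Series) : Set where
  constructor agree
  field coefficient : ∀ {i} → i ℕ.< K → a i ≡ b i
open Agree

agree-≗ : ∀ {K a b} → a ≗ b → Agree K a b
agree-≗ a≗b = agree λ {i} _ → a≗b i

-- Series are functions, so conversion checking would unfold applied sums and
-- products; opacity keeps the ring operations inferable.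
opaque
  infixl 6 _⊕_
  infixl 7 _⊗_
  _⊕_ _⊗_ : Series → Series → Series
  _⊕_ = _+_
  _⊗_ = _*_

  ⊖_ : Series → Series
  (⊖ a) n = ℤ.- a n

  ⊕-def : ∀ a b → a ⊕ b ≡ a + b
  ⊕-def a b = ≡.refl

  ⊗-def : ∀ a b → a ⊗ b ≡ a * b
  ⊗-def a b = ≡.refl

  ⊖-def : ∀ a b → a ⊕ ⊖ b ≡ a - b
  ⊖-def a b = ≡.refl

  truncated-isCommutativeRing : ∀ K → IsCommutativeRing (Agree K) _⊕_ _⊗_ ⊖_ (λ _ → 0ℤ) one
  truncated-isCommutativeRing K = record
    { isRing = record
      { +-isAbelianGroup = record
        { isGroup = record
          { isMonoid = record
            { isSemigroup = record
              { isMagma = record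
                { isEquivalence = record
                  { refl = agree λ _ → ≡.refl
                  ; sym = λ a≈b → agree λ i< → ≡.sym (coefficient a≈b i<)
                  ; trans = λ a≈b b≈c → agree λ i< → ≡.trans (coefficient a≈b i<) (coefficient b≈c i<)
                  }
                ; ∙-cong = λ a≈ b≈ → agree λ i< → ≡.cong₂ ℤ._+_ (coefficient a≈ i<) (coefficient b≈ i<)
                }
              ; assoc = λ a b c → agree-≗ λ i → ℤ.+-assoc (a i) (b i) (c i)
              }
            ; identity = (λ a → agree-≗ λ i → ℤ.+-identityˡ (a i)) , (λ a → agree-≗ λ i → ℤ.+-identityʳ (a i))
            }
          ; inverse = (λ a → agree-≗ λ i → ℤ.+-inverseˡ (a i)) , (λ a → agree-≗ λ i → ℤ.+-inverseʳ (a i))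
          ; ⁻¹-cong = λ a≈ → agree λ i< → ≡.cong ℤ.-_ (coefficient a≈ i<)
          }
        ; comm = λ a b → agree-≗ λ i → ℤ.+-comm (a i) (b i)
        }
      ; *-cong = λ a≈ b≈ → agree λ {n} n< → *-cong-≤ n
          (λ i≤n → coefficient a≈ (ℕ.≤-<-trans i≤n n<)) (λ i≤n → coefficient b≈ (ℕ.≤-<-trans i≤n n<))
      ; *-assoc = λ a b c → agree-≗ (*-assoc a b c)
      ; *-identity = (λ a → agree-≗ (*-identityˡ a)) ,
          (λ a → agree-≗ λ i → ≡.trans (*-comm a one i) (*-identityˡ a i))
      ; distrib = (λ a b c → agree-≗ λ i → ≡.trans (*-comm a (b + c) i) (≡.trans (*-distribʳ-+ a b c i)
                    (≡.cong₂ ℤ._+_ (*-comm b a i) (*-comm c a i)))) ,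
                  (λ c a b → agree-≗ (*-distribʳ-+ c a b))
      }
    ; *-comm = λ a b → agree-≗ (*-comm a b)
    }

truncatedSeries : ℕ → CommutativeRing _ _
truncatedSeries K = record { isCommutativeRing = truncated-isCommutativeRing K }

-- From the truncated rings back to power series.

module Truncation (K : ℕ) where
  open CommutativeRing (truncatedSeries K)
    using (_≈_; 0#; refl; sym; trans; reflexive; setoid; *-cong; *-congˡ; +-congˡ; -‿cong)
    renaming (*-comm to ⊗-comm; *-identityˡ to ⊗-identityˡ)
  open QSeries (truncatedSeries K) using (factorial; factorial-suc; ^-assocʳ) renaming (_^_ to _^ᴷ_)
  open import Relation.Binary.Reasoning.Setoid setoid

  q : Series
  q = q^ 1

  q^ᴷ : ∀ n → q ^ᴷ n ≈ q^ n
  q^ᴷ zero    = refl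
  q^ᴷ (suc n) = begin
    q ⊗ q ^ᴷ n     ≈⟨ *-congˡ (q^ᴷ n) ⟩
    q ⊗ q^ n       ≡⟨ ⊗-def q (q^ n) ⟩
    q * q^ n       ≈⟨ agree-≗ (q^-+ 1 n) ⟩
    q^ suc n       ∎

  q^K≈0 : q ^ᴷ K ≈ 0#
  q^K≈0 = trans (q^ᴷ K) (agree q^-vanish)

  pochhammer≈factorial : ∀ n m → pochhammer n m ≈ factorial (q ^ᴷ n) m
  pochhammer≈factorial n zero    = refl
  pochhammer≈factorial n (suc m) = begin
    (one - q^ (n ℕ.* suc m)) * pochhammer n m
      ≡⟨ ⊗-def (one - q^ (n ℕ.* suc m)) (pochhammer n m) ⟨
    (one - q^ (n ℕ.* suc m)) ⊗ pochhammer n m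
      ≈⟨ ⊗-comm (one - q^ (n ℕ.* suc m)) (pochhammer n m) ⟩
    pochhammer n m ⊗ (one - q^ (n ℕ.* suc m))
      ≈⟨ *-cong (pochhammer≈factorial n m) factor ⟩
    factorial (q ^ᴷ n) m ⊗ (one ⊕ ⊖ ((q ^ᴷ n) ^ᴷ suc m))
      ≈⟨ factorial-suc (q ^ᴷ n) m ⟨
    factorial (q ^ᴷ n) (suc m) ∎
    where
    factor : one - q^ (n ℕ.* suc m) ≈ one ⊕ ⊖ ((q ^ᴷ n) ^ᴷ suc m)
    factor = begin
      one - q^ (n ℕ.* suc m)            ≡⟨ ⊖-def one (q^ (n ℕ.* suc m)) ⟨
      one ⊕ ⊖ (q^ (n ℕ.* suc m))        ≈⟨ +-congˡ (-‿cong (q^ᴷ (n ℕ.* suc m))) ⟨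
      one ⊕ ⊖ (q ^ᴷ (n ℕ.* suc m))      ≈⟨ +-congˡ (-‿cong (^-assocʳ q n (suc m))) ⟨
      one ⊕ ⊖ ((q ^ᴷ n) ^ᴷ suc m)       ∎

  -- By `f-limit`, K factors already determine every coefficient below q^K.
  f≈ : ∀ n .{{_ : NonZero n}} → f n ≈ factorial (q ^ᴷ n) K
  f≈ n = trans (agree λ i< → ≡.sym (f-limit n (ℕ.<⇒≤ i<))) (pochhammer≈factorial n K)

  -- Puts a quotient into the multiplied-out form of the hypotheses of `eta-identity`, with
  -- numerator and denominator rewritten in the truncated ring.
  /-⊗ : ∀ a b {b₀ a′ b′} → a ≈ a′ → b ≈ b′ → (a / b) {b₀} ⊗ b′ ≈ a′
  /-⊗ a b {b₀} {a′} {b′} a≈ b≈ = begin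
    (a / b) {b₀} ⊗ b′   ≈⟨ *-congˡ b≈ ⟨
    (a / b) {b₀} ⊗ b    ≡⟨ ⊗-def ((a / b) {b₀}) b ⟩
    (a / b) {b₀} * b    ≈⟨ agree-≗ (*-/ a b {b₀}) ⟩
    a                   ≈⟨ a≈ ⟩
    a′                  ∎

  invertible : ∀ n .{{_ : NonZero n}} → ∃ λ e → e ⊗ factorial (q ^ᴷ n) K ≈ one
  invertible n = one / f n , /-⊗ one (f n) refl (f≈ n)

  open QSeries.EtaQuotients (truncatedSeries K) q K q^K≈0 invertible using (E; eta-identity)

  ×≈ : ∀ a b {a′ b′} → a ≈ a′ → b ≈ b′ → a * b ≈ a′ ⊗ b′
  ×≈ a b a≈ b≈ = trans (reflexive (≡.sym (⊗-def a b))) (*-cong a≈ b≈)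

  f²≈ : ∀ n .{{_ : NonZero n}} → f n ^ 2 ≈ E n ⊗ E n
  f²≈ n = ×≈ (one * f n) (f n)
    -- The square unfolds to `(one * f n) * f n`; the leading `one` is removed here.
    (trans (reflexive (≡.sym (⊗-def one (f n)))) (trans (⊗-identityˡ (f n)) (f≈ n))) (f≈ n)

  sum≈double :
    (f 1 ^ 2 * f 6) / (f 2 * f 3 ^ 2) + (f 2 ^ 2 * f 12) / (f 4 * f 6 ^ 2)
      ≈ (f 1 * f 16 * f 24 ^ 2) / (f 3 * f 6 * f 8 * f 48) + (f 1 * f 16 * f 24 ^ 2) / (f 3 * f 6 * f 8 * f 48)
  sum≈double = begin
    x + y   ≡⟨ ⊕-def x y ⟨
    x ⊕ y   ≈⟨ eta-identity {x} {y} {z}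
                 (/-⊗ (f 1 ^ 2 * f 6) (f 2 * f 3 ^ 2)
                   (×≈ (f 1 ^ 2) (f 6) (f²≈ 1) (f≈ 6))
                   (×≈ (f 2) (f 3 ^ 2) (f≈ 2) (f²≈ 3)))
                 (/-⊗ (f 2 ^ 2 * f 12) (f 4 * f 6 ^ 2)
                   (×≈ (f 2 ^ 2) (f 12) (f²≈ 2) (f≈ 12))
                   (×≈ (f 4) (f 6 ^ 2) (f≈ 4) (f²≈ 6)))
                 (/-⊗ (f 1 * f 16 * f 24 ^ 2) (f 3 * f 6 * f 8 * f 48)
                   (×≈ (f 1 * f 16) (f 24 ^ 2) (×≈ (f 1) (f 16) (f≈ 1) (f≈ 16)) (f²≈ 24))
                   (×≈ (f 3 * f 6 * f 8) (f 48)
                     (×≈ (f 3 * f 6) (f 8) (×≈ (f 3) (f 6) (f≈ 3) (f≈ 6)) (f≈ 8)) (f≈ 48))) ⟩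
    z ⊕ z   ≡⟨ ⊕-def z z ⟩
    z + z   ∎
    where
    x = (f 1 ^ 2 * f 6) / (f 2 * f 3 ^ 2)
    y = (f 2 ^ 2 * f 12) / (f 4 * f 6 ^ 2)
    z = (f 1 * f 16 * f 24 ^ 2) / (f 3 * f 6 * f 8 * f 48)

double : ∀ c → c ℤ.+ c ≡ + 2 ℤ.* c
double = solve 1 (λ c → c :+ c := con (+ 2) :* c) ≡.refl

lemma3p4 : (f 1 ^ 2 * f 6) / (f 2 * f 3 ^ 2) + (f 2 ^ 2 * f 12) / (f 4 * f 6 ^ 2)
    ≗ (+ 2) · ((f 1 * f 16 * f 24 ^ 2) / (f 3 * f 6 * f 8 * f 48))
-- The coefficient of qⁿ is read off modulo q^(n+1), the first modulus that retains it.
lemma3p4 n = ≡.trans (coefficient (Truncation.sum≈double (suc n)) (ℕ.n<1+n n))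
  (double (((f 1 * f 16 * f 24 ^ 2) / (f 3 * f 6 * f 8 * f 48)) n))
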